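{- Let $A$ be a $\mathrm{QH}_t(m,n;h,k)$ that admits two compatible orderings $\omega_r$ and $\omega_c$. Then there exists a cellular biembedding $\psi$ of $K_{\frac{2nk+t}{t}\times t}$ into an orientable surface such that every edge is on a face whose boundary length is a multiple of $h$ and on a face whose boundary length is a multiple of $k$. Moreover, setting $v=2nk+t$, $\psi$ is $\mathbb{Z}_v$-regular.
   Context: Quasi-Heffter arrays. A partially filled (p.f.) array is a matrix in which some cells may be empty. Let $v=2nk+t$ where $t$ divides $2nk$, and let $J=\frac{v}{t}\mathbb{Z}_v$ be the subgroup of $\mathbb{Z}_v$ of order $t$. A quasi-Heffter array $\mathrm{QH}_t(m,n;h,k)$ is an $m\times n$ p.f. array $A$ with entries in $\mathbb{Z}_v$ such that each row contains exactly $h$ filled cells, each column contains exactly $k$ filled cells, and the multiset $[\pm x\mid x\in A]$ contains each element of $\mathbb{Z}_v\setminus J$ exactly once. $\mathcal{E}(A)$ denotes the list of entries of the filled cells of $A$. Compatible orderings. For each row $R_i$ (column $C_j$) choose a cyclic ordering $\omega_{R_i}$ ($\omega_{C_j}$) of its entries, viewed as a cyclic permutation. Put $\omega_r=\omega_{R_1}\circ\cdots\circ\omega_{R_m}$ and $\omega_c=\omega_{C_1}\circ\cdots\circ\omega_{C_n}$, permutations of $\mathcal{E}(A)$. They are compatible if $\omega_c\circ\omega_r$ is a single cycle of length $|\mathcal{E}(A)|$. Graph. $K_{\frac{v}{t}\times t}$ is the complete multipartite graph with $v/t$ parts each of size $t$. Embeddings. A cellular embedding of a connected graph $\Gamma$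 in a surface is one for which every face (connected component of the complement) is homeomorphic to an open disc. Cellular embeddings in orientable surfaces are equivalently described by pairs $(\Gamma,\rho)$, where $\rho$ is a rotation, i.e. a permutation of the oriented edges of the form $\rho(x,y)=(x,\rho_x(y))$ with each $\rho_x$ a cyclic permutation of all neighbours of $x$; the boundaries of the faces are traced by the orbits of $(x,y)\mapsto\rho(y,x)$, and the length of a face is the length of the orbit. A biembedding is an embedding whose faces can be coloured with two colours so that each edge lies on one face of each colour. An embedding is $\mathbb{Z}_v$-regular if its automorphism group contains a subgroup isomorphic to $\mathbb{Z}_v$ acting sharply transitively on the vertices; an automorphism is a graph automorphism mapping faces to faces. -}

module Defs where

open import Algebra.Bundles.Raw using (RawGroup)
open import Algebra.Morphism.Structures using (module GroupMorphisms)
open import Data.Bool.Base using (Bool)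
open import Data.Fin.Base using (Fin; toℕ)
open import Data.Fin.Properties using (_≟_)
open import Data.List.Base using (List; catMaybes; concat; concatMap; filter; length; tabulate; []; _∷_)
open import Data.List.Membership.Propositional using (_∈_)
open import Data.Maybe.Base using (Maybe)
open import Data.Nat.Base using (ℕ; NonZero; _+_; _*_; _∸_; _/_; _<_)
open import Data.Nat.DivMod using (_mod_)
open import Data.Nat.Divisibility using (_∣_)
open import Data.Nat.GeneralisedArithmetic using (iterate)
open import Data.Product using (∃; ∃!; _×_; _,_; proj₁; map; swap; uncurry)
open import Data.Sum.Base using (_⊎_)
open import Data.Vec.Functional using (foldr)
open import Function.Bundles using (_↔_; _⇔_; Inverse)
open import Function.Construct.Composition using (_↔-∘_)
open import Function.Construct.Identity using (↔-id)
open import Function.Construct.Symmetry using (↔-sym)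
open import Level using (0ℓ)
open import Relation.Binary.Construct.Closure.ReflexiveTransitive using (Star)
open import Relation.Binary.PropositionalEquality using (_≡_; _≢_; sym)
open import Relation.Nullary using (¬_)

open Inverse using (to)

Perm : Set → Set
Perm X = X ↔ X

Sym : Set → RawGroup 0ℓ 0ℓ
Sym X = record
  { Carrier = Perm X
  ; _≈_     = λ π σ → ∀ x → to π x ≡ to σ x
  ; _∙_     = _↔-∘_
  ; ε       = ↔-id X
  ; _⁻¹     = ↔-sym
  }

-- π₁ ∘ π₂ ∘ ⋯ ∘ πₙ
compose : ∀ {X n} → (Fin n → Perm X) → Perm X
compose {X} = foldr _↔-∘_ (↔-id X)

-- A cyclic permutation of the subset S, extended by the identity to all
-- of X.
record CyclicOn {X : Set} (S : X → Set) (π : Perm X) : Set where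
  field
    fixes      : ∀ {x} → ¬ S x → to π x ≡ x
    transitive : ∀ {x y} → S x → S y → ∃ λ i → iterate (to π) x i ≡ y

module _ {v : ℕ} .{{_ : NonZero v}} where

  infixl 6 _+ᵥ_
  infix  8 -ᵥ_

  _+ᵥ_ : Fin v → Fin v → Fin v
  x +ᵥ y = (toℕ x + toℕ y) mod v

  -ᵥ_ : Fin v → Fin v
  -ᵥ x = (v ∸ toℕ x) mod v

ℤ/ : (v : ℕ) .{{_ : NonZero v}} → RawGroup 0ℓ 0ℓ
ℤ/ v = record
  { Carrier = Fin v
  ; _≈_     = _≡_
  ; _∙_     = _+ᵥ_
  ; ε       = 0 mod v
  ; _⁻¹     = -ᵥ_
  }

-- The subgroup (v/t)ℤ_v.
J : (v t : ℕ) .{{_ : NonZero v}} .{{_ : NonZero t}} → Fin v → Set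
J v t x = ∃ λ (y : Fin v) → x ≡ (v / t * toℕ y) mod v

PFArray : Set → ℕ → ℕ → Set
PFArray X m n = Fin m → Fin n → Maybe X

module _ {X : Set} {m n : ℕ} (A : PFArray X m n) where

  row : Fin m → List X
  row i = catMaybes (tabulate λ j → A i j)

  column : Fin n → List X
  column j = catMaybes (tabulate λ i → A i j)

  entries : List X
  entries = concat (tabulate row)

± : ∀ {v} .{{_ : NonZero v}} → List (Fin v) → List (Fin v)
± = concatMap λ x → x ∷ -ᵥ x ∷ []

multiplicity : ∀ {v} → Fin v → List (Fin v) → ℕ
multiplicity x xs = length (filter (_≟ x) xs)

record IsQuasiHeffter {m n v : ℕ} (t h k : ℕ) .{{_ : NonZero t}} .{{_ : NonZero v}}
                      (A : PFArray (Fin v) m n) : Set where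
  field
    order         : v ≡ 2 * n * k + t
    t-divides     : t ∣ 2 * n * k
    row-filled    : ∀ i → length (row A i) ≡ h
    column-filled : ∀ j → length (column A j) ≡ k
    exactly-once  : ∀ x → ¬ J v t x → multiplicity x (± (entries A)) ≡ 1

-- The entries of a quasi-Heffter array are pairwise distinct, so that
-- permutations of the list of entries are permutations of ℤ_v moving
-- only entries of the array.
record CompatibleOrderings {m n v : ℕ} (A : PFArray (Fin v) m n) : Set where
  field
    ωR : Fin m → Perm (Fin v)
    ωC : Fin n → Perm (Fin v)
    ωR-cyclic : ∀ i → CyclicOn (_∈ row A i) (ωR i)
    ωC-cyclic : ∀ j → CyclicOn (_∈ column A j) (ωC j)
    compatible : CyclicOn (_∈ entries A) (compose ωC ↔-∘ compose ωR)

record Graph : Set₁ where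
  field
    V      : Set
    Adj    : V → V → Set
    symm   : ∀ {x y} → Adj x y → Adj y x
    irrefl : ∀ {x} → ¬ Adj x x

-- The complete multipartite graph K_{q × t} with q parts of size t; a
-- vertex is a part together with a position inside it.
K : ℕ → ℕ → Graph
K q t = record
  { V      = Fin q × Fin t
  ; Adj    = λ x y → proj₁ x ≢ proj₁ y
  ; symm   = λ x≢y y≡x → x≢y (sym y≡x)
  ; irrefl = λ x≢x → x≢x _≡_.refl
  }

record Embedding (Γ : Graph) : Set where
  open Graph Γ
  field
    connected : ∀ x y → Star Adj x y
    ρ         : V → Perm V
    rotation  : ∀ x → CyclicOn (Adj x) (ρ x)

  -- Only the pairs satisfying IsDart are oriented edges.  They are
  -- preserved by `next`, and its orbits on them are the faces, so that a
  -- face is given by any one of its darts.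
  Dart : Set
  Dart = V × V

  IsDart : Dart → Set
  IsDart = uncurry Adj

  next : Dart → Dart
  next (x , y) = y , to (ρ y) x

  walk : Dart → ℕ → Dart
  walk = iterate next

  record IsFaceLength (d : Dart) (ℓ : ℕ) : Set where
    field
      positive : 0 < ℓ
      closes   : walk d ℓ ≡ d
      minimal  : ∀ {i} → 0 < i → i < ℓ → walk d i ≢ d

  FaceLengthMultipleOf : ℕ → Dart → Set
  FaceLengthMultipleOf s d = ∃ λ ℓ → IsFaceLength d ℓ × s ∣ ℓ

  -- The two sides of the edge xy are the faces of (x , y) and (y , x).
  record IsBiembedding : Set where
    field
      colour       : Dart → Bool
      well-defined : ∀ {d} → IsDart d → ∀ i → colour (walk d i) ≡ colour d
      both-colours : ∀ {d} → IsDart d → colour d ≢ colour (swap d)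

  HasFacesOfLengths : ℕ → ℕ → Dart → Set
  HasFacesOfLengths h k d =
      (FaceLengthMultipleOf h d × FaceLengthMultipleOf k (swap d))
    ⊎ (FaceLengthMultipleOf k d × FaceLengthMultipleOf h (swap d))

  -- An automorphism may reverse the orientation.  In that case the image
  -- of the boundary walk d₀, d₁, d₂, … of a face, with all its darts
  -- reversed, is a boundary walk traversed backwards from its dart e:
  -- i steps forward from the i-th dart lead to e.
  record IsAutomorphism (σ : Perm V) : Set where
    σ₂ : Dart → Dart
    σ₂ = map (to σ) (to σ)

    field
      adjacency : ∀ {x y} → Adj x y ⇔ Adj (to σ x) (to σ y)
      faces     : ∀ {d} → IsDart d → ∃ λ e → IsDart e ×
                    ( (∀ i → σ₂ (walk d i) ≡ walk e i)
                    ⊎ (∀ i → walk (swap (σ₂ (walk d i))) i ≡ e))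

  -- The image of φ is a subgroup of the automorphism group isomorphic to
  -- ℤ_v.
  record IsRegular (v : ℕ) .{{_ : NonZero v}} : Set where
    field
      φ                  : Fin v → Perm V
      monomorphism       : GroupMorphisms.IsGroupMonomorphism (ℤ/ v) (Sym V) φ
      automorphism       : ∀ a → IsAutomorphism (φ a)
      sharply-transitive : ∀ x y → ∃! _≡_ λ a → to (φ a) x ≡ y

{-# OPTIONS --safe #-}

-- Write E for the set of entries.  By counting, ℤ_v is the disjoint union
-- of E, -E and J.  Let r be the permutation of ℤ_v with r(a) = -ω_r(a) and
-- r(-a) = ω_c(a) for a ∈ E, and r = id on J.  Its square acts on E as
-- ω_c ∘ ω_r, so compatibility makes r cyclic on ℤ_v ∖ J, and
-- ρ_x(x + a) = x + r(a) is a rotation invariant under translations.  Along a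
-- face, the difference δ of the two ends of a dart becomes r(-δ): if δ ∈ E
-- the differences run through the ω_c-orbit of δ, of size k, and otherwise
-- their opposites run through an ω_r-orbit, of size h.

module Submission where

open import Defs
open import Algebra.Bundles using (Group; CommutativeMonoid)
import Algebra.Properties.CommutativeSemigroup as CommutativeSemigroupProperties
import Algebra.Properties.Group as GroupProperties
open import Data.Fin.Base using (Fin; zero; suc; toℕ; fromℕ<; combine)
open import Data.Fin.Properties
  using (_≟_; toℕ<n; suc-injective; toℕ-injective; toℕ-fromℕ<; fromℕ<-cong; pigeonhole;
        injective⇒≤; combine-injective)
open import Data.List.Base
  using (List; []; _∷_; _++_; length; lookup; tabulate; concat; catMaybes; filter; fromMaybe;
        map; allFin)
open import Data.List.Properties
  using (tabulate-lookup; tabulate-cong; length-++; length-map; length-tabulate)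
open import Data.List.Membership.Propositional using (_∈_; _∉_)
open import Data.List.Membership.Propositional.Properties
  using (∈-lookup; ∈-++⁺ˡ; ∈-++⁺ʳ; ∈-filter⁻; ∈-map⁺; ∈-allFin; ∈-concat⁺′; ∈-concat⁻′;
        ∈-tabulate⁺; ∈-tabulate⁻)
import Data.List.Membership.DecPropositional as DecMembership
import Data.List.Membership.Setoid.Properties as SetoidMembership
open import Data.List.Relation.Unary.Any using (here; there; index)
open import Data.List.Relation.Unary.Any.Properties using (lookup-index)
open import Data.List.Relation.Unary.All as All using (All; []; _∷_)
import Data.List.Relation.Unary.All.Properties as All
open import Data.List.Relation.Unary.AllPairs using ([]; _∷_)
open import Data.List.Relation.Unary.Unique.Propositional using (Unique)
open import Data.List.Relation.Unary.Unique.Propositional.Properties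
  using (tabulate⁺; Unique[x∷xs]⇒x∉xs)
open import Data.List.Relation.Binary.Disjoint.Propositional using (Disjoint)
open import Data.List.Relation.Binary.Permutation.Propositional
  using (_↭_; ↭⇒↭ₛ; ↭-refl; ↭-sym; ↭-trans; ↭-reflexive)
open import Data.List.Relation.Binary.Permutation.Propositional.Properties
  using (++⁺ˡ; ++-commutativeMonoid; ↭-length; ∈-resp-↭)
import Data.List.Relation.Binary.Permutation.Setoid.Properties as SetoidPermutation
open import Data.Maybe.Base using (Maybe; just; nothing)
open import Data.Nat.Base
  using (ℕ; zero; suc; NonZero; _+_; _*_; _∸_; _/_; _%_; _<_; _≤_; z<s; >-nonZero)
import Data.Nat.Properties as ℕ
open import Data.Nat.Divisibility using (_∣_; divides; ∣m∣n⇒∣m+n; ∣-refl)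
open import Data.Nat.DivMod
open import Data.Nat.GeneralisedArithmetic using (iterate)
open import Data.Nat.Induction using (<-rec)
open import Data.Product as Product using (Σ; ∃; _×_; _,_; proj₁; proj₂; swap)
open import Data.Sum.Base using (_⊎_; inj₁; inj₂)
open import Data.Bool.Base using (Bool; true; false)
open import Data.Unit.Base using (⊤; tt)
open import Function.Base using (_∘_)
open import Function.Bundles using (Inverse; mk⇔; mk↔ₛ′; _↔_)
open import Function.Construct.Composition using (_↔-∘_)
open import Function.Construct.Symmetry using (↔-sym)
open import Function.Definitions using (Injective)
open import Function.Consequences.Propositional using (inverseʳ⇒injective)
open import Relation.Binary.Construct.Closure.ReflexiveTransitive using (Star; ε; _◅_)
open import Relation.Binary.Definitions using (tri<; tri≈; tri>)
open import Relation.Binary.PropositionalEquality hiding (J)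
open import Relation.Nullary using (¬_; yes; no; does; contradiction)
open import Relation.Nullary.Decidable using (map′; decidable-stable; dec-true; dec-false; _×-dec_)
open import Relation.Unary using (Decidable)

open Inverse using (to; from)
open ≡-Reasoning

-- Nothing forces the sum of a row or a column to vanish. After one turn of its cycle the difference
-- of a dart is back, but the dart itself may have been translated; this is why faces have lengths
-- that are only multiples of h and k. Accordingly no length is computed: a least return time exists
-- because V × V is finite, and a return of the dart is a return of its difference, so the length of
-- the cycle divides it.
--
-- The field `exactly-once` constrains only residues outside J. That no entry lies in J comes from
-- the total 2nk + t = v, where the 2nk signed entries and the t elements of J leave no room for a
-- repetition.
--
-- A rotation is a permutation of all vertices and must fix the part of its centre pointwise. The
-- parts are the cosets of J, that is, the fibres of reduction modulo v / t, so negation has to be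
-- switched off on J.

private
  variable
    X Y : Set

to-injective : (π : X ↔ Y) → Injective _≡_ _≡_ (to π)
to-injective π = inverseʳ⇒injective (to π) (Inverse.inverseʳ π)

-- Iterates and periods

iterate-+ : (f : X → X) (x : X) (i {j} : ℕ) →
            iterate f x (i + j) ≡ iterate f (iterate f x i) j
iterate-+ f x zero    = refl
iterate-+ f x (suc i) = iterate-+ f (f x) i

iterate-injective : {f : X → X} → Injective _≡_ _≡_ f →
                    ∀ i → Injective _≡_ _≡_ (λ x → iterate f x i)
iterate-injective inj zero    eq = eq
iterate-injective inj (suc i) eq = inj (iterate-injective inj i eq)

iterate-* : {f : X → X} {x : X} {p : ℕ} → iterate f x p ≡ x → ∀ c → iterate f x (c * p) ≡ x
iterate-* eq zero = refl
iterate-* {f = f} {x} {p} eq (suc c) = begin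
  iterate f x (p + c * p)             ≡⟨ iterate-+ f x p ⟩
  iterate f (iterate f x p) (c * p)   ≡⟨ cong (λ y → iterate f y (c * p)) eq ⟩
  iterate f x (c * p)                 ≡⟨ iterate-* eq c ⟩
  x                                   ∎

iterate-% : {f : X → X} {x : X} {p : ℕ} .{{_ : NonZero p}} → iterate f x p ≡ x →
            ∀ n → iterate f x (n % p) ≡ iterate f x n
iterate-% {f = f} {x} {p} closes n = begin
  iterate f x (n % p)                          ≡⟨ cong (λ y → iterate f y (n % p)) (iterate-* closes (n / p)) ⟨
  iterate f (iterate f x (n / p * p)) (n % p)  ≡⟨ iterate-+ f x (n / p * p) ⟨
  iterate f x (n / p * p + n % p)              ≡⟨ cong (iterate f x) (ℕ.+-comm (n / p * p) (n % p)) ⟩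
  iterate f x (n % p + n / p * p)              ≡⟨ cong (iterate f x) (m≡m%n+[m/n]*n n p) ⟨
  iterate f x n                                ∎

module _ {Q : Y → Set} {f : X → X} {f′ : Y → Y} (g : X → Y) where

  -- Commutation is asked only where `Q` holds, because differences follow `C` or `R` along a face
  -- only while they, or their opposites, are entries. `Q` is put on the image, where `f′` is known
  -- to preserve it.
  iterate-map : (∀ {x} → Q (g x) → g (f x) ≡ f′ (g x)) → (∀ {y} → Q y → Q (f′ y)) →
                ∀ {x} → Q (g x) → ∀ i → g (iterate f x i) ≡ iterate f′ (g x) i
  iterate-map commute preserve q zero = refl
  iterate-map commute preserve {x} q (suc i) = begin
    g (iterate f (f x) i)    ≡⟨ iterate-map commute preserve (subst Q (sym (commute q)) (preserve q)) i ⟩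
    iterate f′ (g (f x)) i   ≡⟨ cong (λ y → iterate f′ y i) (commute q) ⟩
    iterate f′ (f′ (g x)) i  ∎

iterate-preserves : (Q : X → Set) {f : X → X} → (∀ {x} → Q x → Q (f x)) →
                    ∀ {x} → Q x → ∀ i → Q (iterate f x i)
iterate-preserves Q preserve q zero    = q
iterate-preserves Q preserve q (suc i) = iterate-preserves Q preserve (preserve q) i

record IsPeriod (f : X → X) (x : X) (p : ℕ) : Set where
  field
    positive : 0 < p
    closes   : iterate f x p ≡ x
    minimal  : ∀ {i} → 0 < i → i < p → iterate f x i ≢ x

least : {P : ℕ → Set} → Decidable P → ∀ n → P n → ∃ λ p → P p × (∀ {i} → i < p → ¬ P i)
least {P} P? = <-rec _ λ n rec Pn → search n rec Pn
  where
  search : ∀ n → (∀ {i} → i < n → P i → ∃ λ p → P p × (∀ {i} → i < p → ¬ P i)) →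
           P n → ∃ λ p → P p × (∀ {i} → i < p → ¬ P i)
  search n rec Pn with ℕ.anyUpTo? P? n
  ... | yes (i , i<n , Pi) = rec i<n Pi
  ... | no  none           = n , Pn , λ i<n Pi → none (_ , i<n , Pi)

-- Injectivity cancels the last i steps, so any collision among iterates is already a return to the
-- start.
returns : {f : X → X} → Injective _≡_ _≡_ f → ∀ {x i j} → i < j →
          iterate f x i ≡ iterate f x j → iterate f x (j ∸ i) ≡ x
returns {f = f} inj {x} {i} {j} i<j eq = iterate-injective inj i (begin
  iterate f (iterate f x (j ∸ i)) i  ≡⟨ iterate-+ f x (j ∸ i) ⟨
  iterate f x (j ∸ i + i)            ≡⟨ cong (iterate f x) (ℕ.m∸n+n≡m (ℕ.<⇒≤ i<j)) ⟩
  iterate f x j                      ≡⟨ eq ⟨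
  iterate f x i                      ∎)

-- The code has two uses: finiteness, which forces a collision among the first N + 1 iterates, and
-- decidable equality, which lets the return time be minimised.
period-exists : ∀ {N} {f : X → X} {code : X → Fin N} → Injective _≡_ _≡_ code →
                Injective _≡_ _≡_ f → ∀ x → ∃ (IsPeriod f x)
period-exists {N = N} {f} {code} code-injective inj x
  with i , j , i<j , eq ← pigeonhole (ℕ.n<1+n N) (code ∘ iterate f x ∘ toℕ)
  with p , (0<p , closes) , below ← least
         (λ i → (0 ℕ.<? i) ×-dec map′ code-injective (cong code) (code (iterate f x i) ≟ code x))
         (toℕ j ∸ toℕ i) (ℕ.m<n⇒0<n∸m i<j , returns inj i<j (code-injective eq))
  = p , record { positive = 0<p ; closes = closes ; minimal = λ 0<i i<p eq → below i<p (0<i , eq) }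

period-∣ : ∀ {f : X → X} {x p n} → IsPeriod f x p → iterate f x n ≡ x → p ∣ n
period-∣ {f = f} {x} {p@(suc _)} {n} period eq = divides (n / p) (begin
  n                  ≡⟨ m≡m%n+[m/n]*n n p ⟩
  n % p + n / p * p  ≡⟨ cong (_+ n / p * p) (remainder≡0 (n % p) (trans (iterate-% closes n) eq) (m%n<n n p)) ⟩
  n / p * p          ∎)
  where
  open IsPeriod period
  remainder≡0 : ∀ r → iterate f x r ≡ x → r < p → r ≡ 0
  remainder≡0 zero    _  _   = refl
  remainder≡0 (suc r) eq r<p = contradiction eq (minimal z<s r<p)

no-repetition : {f : X → X} → Injective _≡_ _≡_ f → ∀ {x p} → IsPeriod f x p →
                ∀ {i j} → i < j → j < p → iterate f x i ≢ iterate f x j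
no-repetition inj period {i} {j} i<j j<p eq = IsPeriod.minimal period
  (ℕ.m<n⇒0<n∸m i<j) (ℕ.≤-<-trans (ℕ.m∸n≤m j i) j<p) (returns inj i<j eq)

period-injective : {f : X → X} → Injective _≡_ _≡_ f → ∀ {x p} → IsPeriod f x p →
                   Injective _≡_ _≡_ (λ (i : Fin p) → iterate f x (toℕ i))
period-injective inj period {i} {j} eq with ℕ.<-cmp (toℕ i) (toℕ j)
... | tri< i<j _ _ = contradiction eq (no-repetition inj period i<j (toℕ<n j))
... | tri≈ _ i≡j _ = toℕ-injective i≡j
... | tri> _ _ j<i = contradiction (sym eq) (no-repetition inj period j<i (toℕ<n i))

index-injective : ∀ {xs : List X} {x y} (x∈xs : x ∈ xs) (y∈xs : y ∈ xs) →
                  index x∈xs ≡ index y∈xs → x ≡ y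
index-injective = SetoidMembership.index-injective (setoid _)

lookup-injective : {xs : List X} → Unique xs → Injective _≡_ _≡_ (lookup xs)
lookup-injective {xs = x ∷ xs} u {zero}  {zero}  eq = refl
lookup-injective {xs = x ∷ xs} u {zero}  {suc j} eq =
  contradiction (subst (_∈ xs) (sym eq) (∈-lookup j)) (Unique[x∷xs]⇒x∉xs u)
lookup-injective {xs = x ∷ xs} u {suc i} {zero}  eq =
  contradiction (subst (_∈ xs) eq (∈-lookup i)) (Unique[x∷xs]⇒x∉xs u)
lookup-injective {xs = x ∷ xs} (_ ∷ u) {suc i} {suc j} eq = cong suc (lookup-injective u eq)

-- Two injections in opposite directions: an exponent below p goes to the position of its iterate,
-- and a position goes to an exponent reaching its element, reduced modulo p.
period-length : {f : X → X} → Injective _≡_ _≡_ f → ∀ {xs x p} → Unique xs → IsPeriod f x p →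
                (∀ i → iterate f x i ∈ xs) → (∀ {y} → y ∈ xs → ∃ λ i → iterate f x i ≡ y) →
                p ≡ length xs
period-length {f = f} inj {xs} {x} {p@(suc _)} unique period inside reach =
  ℕ.≤-antisym
    (injective⇒≤ {f = λ i → index (inside (toℕ i))} λ {i} {j} eq →
      period-injective inj period (index-injective (inside (toℕ i)) (inside (toℕ j)) eq))
    (injective⇒≤ {f = λ i → exponent i mod p} λ {i} {j} eq →
      lookup-injective unique (begin
        lookup xs i                               ≡⟨ exponent-mod i ⟨
        iterate f x (toℕ (exponent i mod p))      ≡⟨ cong (iterate f x ∘ toℕ) eq ⟩
        iterate f x (toℕ (exponent j mod p))      ≡⟨ exponent-mod j ⟩
        lookup xs j                               ∎))
  where
  exponent : Fin (length xs) → ℕ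
  exponent i = proj₁ (reach (∈-lookup i))
  exponent-mod : ∀ i → iterate f x (toℕ (exponent i mod p)) ≡ lookup xs i
  exponent-mod i = begin
    iterate f x (toℕ (exponent i mod p))  ≡⟨ cong (iterate f x) (toℕ-fromℕ< (m%n<n (exponent i) p)) ⟩
    iterate f x (exponent i % p)          ≡⟨ iterate-% (IsPeriod.closes period) (exponent i) ⟩
    iterate f x (exponent i)              ≡⟨ proj₂ (reach (∈-lookup i)) ⟩
    lookup xs i                           ∎

-- Once m and n are identified, y lies on a cycle of f, and the iterate just before the return to y
-- is a preimage.
injective⇒surjective : ∀ {m n} {f : Fin m → Fin n} → m ≡ n → Injective _≡_ _≡_ f →
                       ∀ y → ∃ λ x → f x ≡ y
injective⇒surjective {f = f} refl inj y
  with suc p , period ← period-exists (λ eq → eq) inj y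
  = iterate f y p , trans (sym (iterate-suc p y)) (IsPeriod.closes period)
  where
  iterate-suc : ∀ i x → iterate f x (suc i) ≡ f (iterate f x i)
  iterate-suc zero    x = refl
  iterate-suc (suc i) x = iterate-suc i (f x)

-- Lists without repetitions

-- Choosing a position for each element is injective, hence onto by counting. The choice is then a
-- left inverse of `lookup`, which is therefore injective.
covering⇒unique : ∀ {n} (xs : List (Fin n)) → length xs ≡ n → (∀ x → x ∈ xs) → Unique xs
covering⇒unique xs len cover = subst Unique (tabulate-lookup xs) (tabulate⁺ λ {i} {j} eq → begin
  i                ≡⟨ proj₂ (onto i) ⟨
  position (at i)  ≡⟨ cong position (lookup-onto i) ⟨
  position (lookup xs i) ≡⟨ cong position eq ⟩
  position (lookup xs j) ≡⟨ cong position (lookup-onto j) ⟩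
  position (at j)  ≡⟨ proj₂ (onto j) ⟩
  j                ∎)
  where
  position : Fin _ → Fin (length xs)
  position x = index (cover x)
  onto : ∀ i → ∃ λ x → position x ≡ i
  onto = injective⇒surjective (sym len) (λ {x} {y} → index-injective (cover x) (cover y))
  at : Fin (length xs) → Fin _
  at i = proj₁ (onto i)
  lookup-onto : ∀ i → lookup xs i ≡ at i
  lookup-onto i = trans (cong (lookup xs) (sym (proj₂ (onto i)))) (sym (lookup-index (cover (at i))))

unique-++⁻ : ∀ (xs : List X) {ys} → Unique (xs ++ ys) → Unique xs × Unique ys × Disjoint xs ys
unique-++⁻ []       u         = [] , u , λ ()
unique-++⁻ (x ∷ xs) (x≢ ∷ u) with unique-++⁻ xs u
... | uxs , uys , disjoint = All.++⁻ˡ xs x≢ ∷ uxs , uys , λ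
  { (here refl , x∈ys)  → All.lookup (All.++⁻ʳ xs x≢) x∈ys refl
  ; (there x∈xs , x∈ys) → disjoint (x∈xs , x∈ys) }

∈-union : ∀ {n} (f : Fin n → List X) {x} i → x ∈ f i → x ∈ concat (tabulate f)
∈-union f i x∈ = ∈-concat⁺′ x∈ (∈-tabulate⁺ i)

∈-union⁻ : ∀ {n} (f : Fin n → List X) {x} → x ∈ concat (tabulate f) → ∃ λ i → x ∈ f i
∈-union⁻ f x∈ with ∈-concat⁻′ (tabulate f) x∈
... | xs , x∈xs , xs∈ with ∈-tabulate⁻ xs∈
... | i , refl = i , x∈xs

unique-union⁻ : ∀ {n} (f : Fin n → List X) → Unique (concat (tabulate f)) →
                (∀ i → Unique (f i)) × (∀ {i j x} → x ∈ f i → x ∈ f j → i ≡ j)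
unique-union⁻ {n = zero}  f u = (λ ()) , λ { {()} }
unique-union⁻ {X = X} {n = suc n} f u with unique-++⁻ (f zero) u
... | u₀ , u′ , disjoint with unique-union⁻ (f ∘ suc) u′
... | uₛ , same = unique , same′
  where
  unique : ∀ i → Unique (f i)
  unique zero    = u₀
  unique (suc i) = uₛ i
  same′ : ∀ {i j} {x : X} → x ∈ f i → x ∈ f j → i ≡ j
  same′ {zero}  {zero}  _  _  = refl
  same′ {zero}  {suc j} x∈ x∈′ = contradiction (x∈ , ∈-union (f ∘ suc) j x∈′) disjoint
  same′ {suc i} {zero}  x∈ x∈′ = contradiction (x∈′ , ∈-union (f ∘ suc) i x∈) disjoint
  same′ {suc i} {suc j} x∈ x∈′ = cong suc (same x∈ x∈′)

length-union : ∀ {n s} (f : Fin n → List X) → (∀ i → length (f i) ≡ s) →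
               length (concat (tabulate f)) ≡ n * s
length-union {n = zero}  f len = refl
length-union {n = suc n} f len =
  trans (length-++ (f zero)) (cong₂ _+_ (len zero) (length-union (f ∘ suc) (len ∘ suc)))

concat-tabulate-++ : ∀ {n} (f g : Fin n → List X) →
  concat (tabulate λ i → f i ++ g i) ↭ concat (tabulate f) ++ concat (tabulate g)
concat-tabulate-++ {n = zero}  f g = ↭-refl
concat-tabulate-++ {n = suc n} f g =
  ↭-trans (++⁺ˡ (f zero ++ g zero) (concat-tabulate-++ (f ∘ suc) (g ∘ suc)))
          (interchange (f zero) (g zero) (concat (tabulate (f ∘ suc))) (concat (tabulate (g ∘ suc))))
  where open CommutativeSemigroupProperties (CommutativeMonoid.commutativeSemigroup ++-commutativeMonoid)

catMaybes-∷ : (x : Maybe X) (xs : List (Maybe X)) → catMaybes (x ∷ xs) ≡ fromMaybe x ++ catMaybes xs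
catMaybes-∷ (just x) xs = refl
catMaybes-∷ nothing  xs = refl

concat-fromMaybe : ∀ {n} (f : Fin n → Maybe X) →
                   catMaybes (tabulate f) ≡ concat (tabulate (fromMaybe ∘ f))
concat-fromMaybe {n = zero}  f = refl
concat-fromMaybe {n = suc n} f =
  trans (catMaybes-∷ (f zero) (tabulate (f ∘ suc))) (cong (fromMaybe (f zero) ++_) (concat-fromMaybe (f ∘ suc)))

-- Induction on the rows: a filled cell of the first row is the head of its column. A cell counts as
-- a list of at most one term, so detaching all the heads gives the first row followed by the
-- columns of the remaining rows.
entries-transpose : ∀ {m n} (A : PFArray X m n) → entries A ↭ concat (tabulate (column A))
entries-transpose {m = zero}  {n} A = ↭-reflexive (sym (empty n))
  where
  empty : ∀ n → concat (tabulate {n = n} λ _ → []) ≡ []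
  empty zero    = refl
  empty (suc n) = empty n
entries-transpose {m = suc m} A =
  ↭-trans (++⁺ˡ (row A zero) (entries-transpose (A ∘ suc)))
  (↭-trans (↭-reflexive (cong (_++ concat (tabulate (column (A ∘ suc)))) (concat-fromMaybe (A zero))))
  (↭-trans (↭-sym (concat-tabulate-++ (fromMaybe ∘ A zero) (column (A ∘ suc))))
  (↭-reflexive (cong concat (tabulate-cong λ j → sym (catMaybes-∷ (A zero j) (tabulate λ i → A (suc i) j)))))))

-- Compositions of disjoint cycles

module _ {S : X → Set} (S? : Decidable S) (π : Perm X) (fixes : ∀ {x} → ¬ S x → to π x ≡ x) where

  -- If π x were outside S it would be a fixed point, and injectivity would give π x = x, which is
  -- in S.
  preserves : ∀ {x} → S x → S (to π x)
  preserves {x} Sx = decidable-stable (S? (to π x)) λ ¬Sπx →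
    ¬Sπx (subst S (sym (to-injective π (fixes ¬Sπx))) Sx)

  preserves⁻¹ : ∀ {x} → S x → S (from π x)
  preserves⁻¹ {x} Sx = decidable-stable (S? (from π x)) λ ¬Sπ⁻¹x →
    ¬Sπ⁻¹x (subst S (trans (sym (Inverse.strictlyInverseˡ π x)) (fixes ¬Sπ⁻¹x)) Sx)

compose-fixes : ∀ {n} {S : Fin n → X → Set} {π : Fin n → Perm X} →
                (∀ i {x} → ¬ S i x → to (π i) x ≡ x) →
                ∀ {x} → (∀ i → ¬ S i x) → to (compose π) x ≡ x
compose-fixes {n = zero}  fixes ¬S = refl
compose-fixes {n = suc n} {π = π} fixes ¬S =
  trans (cong (to (π zero)) (compose-fixes (fixes ∘ suc) (¬S ∘ suc))) (fixes zero (¬S zero))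

-- The factors applied before the i-th fix x; the i-th keeps its image in `S i`, outside the other
-- supports, so the factors applied afterwards fix that image.
compose-acts : ∀ {n} {S : Fin n → X → Set} {π : Fin n → Perm X} →
               (∀ i → Decidable (S i)) → (∀ i {x} → ¬ S i x → to (π i) x ≡ x) →
               (∀ {i j x} → S i x → S j x → i ≡ j) →
               ∀ {i x} → S i x → to (compose π) x ≡ to (π i) x
compose-acts {π = π} S? fixes same {zero} Sx = cong (to (π zero))
  (compose-fixes (fixes ∘ suc) λ j Sⱼx → contradiction (same Sx Sⱼx) λ ())
compose-acts {S = S} {π} S? fixes same {suc i} Sx = trans
  (cong (to (π zero)) (compose-acts (S? ∘ suc) (fixes ∘ suc) (λ p q → suc-injective (same p q)) Sx))
  (fixes zero λ S₀x → contradiction (same S₀x (preserves (S? (suc i)) (π (suc i)) (fixes (suc i)) Sx)) λ ())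

module CyclesOnUnion {v n s : ℕ} (xs : Fin n → List (Fin v)) (ω : Fin n → Perm (Fin v))
                     (cyclic : ∀ i → CyclicOn (_∈ xs i) (ω i))
                     (unique : Unique (concat (tabulate xs)))
                     (length-xs : ∀ i → length (xs i) ≡ s) where

  open DecMembership (_≟_ {v}) using (_∈?_)

  Ω : Perm (Fin v)
  Ω = compose ω

  ω-fixes : ∀ i {x} → x ∉ xs i → to (ω i) x ≡ x
  ω-fixes i = CyclicOn.fixes (cyclic i)

  ω-preserves : ∀ i {x} → x ∈ xs i → to (ω i) x ∈ xs i
  ω-preserves i = preserves (_∈? xs i) (ω i) (ω-fixes i)

  Ω-fixes : ∀ {x} → x ∉ concat (tabulate xs) → to Ω x ≡ x
  Ω-fixes x∉ = compose-fixes ω-fixes λ i x∈ → x∉ (∈-union xs i x∈)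

  Ω-acts : ∀ {i x} → x ∈ xs i → to Ω x ≡ to (ω i) x
  Ω-acts = compose-acts (λ i → _∈? xs i) ω-fixes (proj₂ (unique-union⁻ xs unique))

  -- On the list containing x, `Ω` agrees with one cycle running through that whole list, so the
  -- period of x is the length of the list.
  Ω-period : ∀ {x} → x ∈ concat (tabulate xs) → ∀ {l} → iterate (to Ω) x l ≡ x → s ∣ l
  Ω-period {x} x∈ {l} eq with i , x∈xsᵢ ← ∈-union⁻ xs x∈
                         with p , period ← period-exists (λ eq → eq) (to-injective (ω i)) x =
    subst (_∣ l)
      (trans (period-length (to-injective (ω i)) (proj₁ (unique-union⁻ xs unique) i) period
                (iterate-preserves (_∈ xs i) (ω-preserves i) x∈xsᵢ) (CyclicOn.transitive (cyclic i) x∈xsᵢ))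
             (length-xs i))
      (period-∣ period (trans (sym (iterate-map {Q = _∈ xs i} (λ y → y) Ω-acts (ω-preserves i) x∈xsᵢ l)) eq))

-- The cyclic group

module _ {n : ℕ} .{{_ : NonZero n}} where

  toℕ-mod : ∀ a → toℕ (a mod n) ≡ a % n
  toℕ-mod a = toℕ-fromℕ< (m%n<n a n)

  mod-cong : ∀ {a b} → a % n ≡ b % n → a mod n ≡ b mod n
  mod-cong eq = fromℕ<-cong _ _ eq _ _

  mod-toℕ : ∀ x → toℕ x mod n ≡ x
  mod-toℕ x = toℕ-injective (trans (toℕ-mod (toℕ x)) (m<n⇒m%n≡m (toℕ<n x)))

  -- Reduction is a homomorphism from ℕ with section `toℕ`; through it the group laws descend from
  -- addition of natural numbers.
  mod-+ : ∀ a b → (a mod n) +ᵥ (b mod n) ≡ (a + b) mod n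
  mod-+ a b = mod-cong (begin
    (toℕ (a mod n) + toℕ (b mod n)) % n  ≡⟨ cong₂ (λ c d → (c + d) % n) (toℕ-mod a) (toℕ-mod b) ⟩
    (a % n + b % n) % n                  ≡⟨ %-distribˡ-+ a b n ⟨
    (a + b) % n                          ∎)

cyclicGroup : (n : ℕ) .{{_ : NonZero n}} → Group _ _
cyclicGroup n = record
  { Carrier = Fin n
  ; _≈_     = _≡_
  ; _∙_     = _+ᵥ_
  ; ε       = 0 mod n
  ; _⁻¹     = -ᵥ_
  ; isGroup = record
    { isMonoid = record
      { isSemigroup = record
        { isMagma = record { isEquivalence = isEquivalence ; ∙-cong = cong₂ _+ᵥ_ }
        ; assoc   = assoc
        }
      ; identity = identityˡ , λ x → trans (comm x (0 mod n)) (identityˡ x)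
      }
    ; inverse = (λ x → trans (comm (-ᵥ x) x) (inverseʳ x)) , inverseʳ
    ; ⁻¹-cong = cong -ᵥ_
    }
  }
  where
  comm : ∀ (x y : Fin n) → x +ᵥ y ≡ y +ᵥ x
  comm x y = cong (_mod n) (ℕ.+-comm (toℕ x) (toℕ y))
  assoc : ∀ (x y z : Fin n) → (x +ᵥ y) +ᵥ z ≡ x +ᵥ (y +ᵥ z)
  assoc x y z = begin
    (x +ᵥ y) +ᵥ z                              ≡⟨ cong ((x +ᵥ y) +ᵥ_) (mod-toℕ z) ⟨
    (x +ᵥ y) +ᵥ (toℕ z mod n)                  ≡⟨ mod-+ (toℕ x + toℕ y) (toℕ z) ⟩
    (toℕ x + toℕ y + toℕ z) mod n              ≡⟨ cong (_mod n) (ℕ.+-assoc (toℕ x) (toℕ y) (toℕ z)) ⟩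
    (toℕ x + (toℕ y + toℕ z)) mod n            ≡⟨ mod-+ (toℕ x) (toℕ y + toℕ z) ⟨
    (toℕ x mod n) +ᵥ (y +ᵥ z)                  ≡⟨ cong (_+ᵥ (y +ᵥ z)) (mod-toℕ x) ⟩
    x +ᵥ (y +ᵥ z)                              ∎
  identityˡ : ∀ (x : Fin n) → (0 mod n) +ᵥ x ≡ x
  identityˡ x = begin
    (0 mod n) +ᵥ x              ≡⟨ cong ((0 mod n) +ᵥ_) (mod-toℕ x) ⟨
    (0 mod n) +ᵥ (toℕ x mod n)  ≡⟨ mod-+ 0 (toℕ x) ⟩
    toℕ x mod n                 ≡⟨ mod-toℕ x ⟩
    x                           ∎
  inverseʳ : ∀ (x : Fin n) → x +ᵥ -ᵥ x ≡ 0 mod n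
  inverseʳ x = begin
    x +ᵥ -ᵥ x                     ≡⟨ cong (_+ᵥ -ᵥ x) (mod-toℕ x) ⟨
    (toℕ x mod n) +ᵥ -ᵥ x         ≡⟨ mod-+ (toℕ x) (n ∸ toℕ x) ⟩
    (toℕ x + (n ∸ toℕ x)) mod n   ≡⟨ cong (_mod n) (ℕ.m+[n∸m]≡n (ℕ.<⇒≤ (toℕ<n x))) ⟩
    n mod n                       ≡⟨ mod-cong (trans (n%n≡0 n) (sym (m*n%n≡0 0 n))) ⟩
    0 mod n                       ∎

-- The vertex (c , p) of K q t is the residue p q + c.
module Residues (q t v : ℕ) .{{_ : NonZero q}} .{{_ : NonZero v}} (q*t≡v : q * t ≡ v) where

  q∣v : q ∣ v
  q∣v = divides t (trans (sym q*t≡v) (ℕ.*-comm q t))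

  part : Fin v → Fin q
  part x = toℕ x mod q

  part-mod : ∀ a → part (a mod v) ≡ a mod q
  part-mod a = mod-cong (trans (cong (_% q) (toℕ-mod a)) (m∣n⇒o%n%m≡o%m q v a q∣v))

  part-+ : ∀ x y → part (x +ᵥ y) ≡ part x +ᵥ part y
  part-+ x y = trans (part-mod (toℕ x + toℕ y)) (sym (mod-+ (toℕ x) (toℕ y)))

  x<t*q : ∀ (x : Fin v) → toℕ x < t * q
  x<t*q x = subst (toℕ x <_) (trans (sym q*t≡v) (ℕ.*-comm q t)) (toℕ<n x)

  -- Sealed so that quotients and remainders do not unfold in later goals, which rely on the two
  -- inverse laws and on `part-vertex` instead.
  abstract

    residue : Fin q × Fin t → Fin v
    residue (c , p) = (toℕ c + toℕ p * q) mod v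

    toℕ-residue : ∀ c p → toℕ (residue (c , p)) ≡ toℕ c + toℕ p * q
    toℕ-residue c p = trans (toℕ-mod (toℕ c + toℕ p * q)) (m<n⇒m%n≡m (subst (toℕ c + toℕ p * q <_)
      (trans (ℕ.*-comm t q) q*t≡v)
      (ℕ.<-≤-trans (ℕ.+-monoˡ-< (toℕ p * q) (toℕ<n c)) (ℕ.*-monoˡ-≤ q (toℕ<n p)))))

    position : Fin v → Fin t
    position x = fromℕ< (m<n*o⇒m/o<n {n = t} (x<t*q x))

    toℕ-position : ∀ x → toℕ (position x) ≡ toℕ x / q
    toℕ-position x = toℕ-fromℕ< (m<n*o⇒m/o<n {n = t} (x<t*q x))

    vertex : Fin v → Fin q × Fin t
    vertex x = part x , position x

    part-vertex : ∀ x → proj₁ (vertex x) ≡ part x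
    part-vertex x = refl

    vertex-residue : ∀ w → vertex (residue w) ≡ w
    vertex-residue (c , p) = cong₂ _,_
      (trans (part-mod (toℕ c + toℕ p * q)) (trans (mod-cong ([m+kn]%n≡m%n (toℕ c) (toℕ p) q)) (mod-toℕ c)))
      (toℕ-injective (begin
        toℕ (position (residue (c , p)))           ≡⟨ toℕ-position (residue (c , p)) ⟩
        toℕ (residue (c , p)) / q                  ≡⟨ cong (_/ q) (toℕ-residue c p) ⟩
        (toℕ c + toℕ p * q) / q                    ≡⟨ +-distrib-/-∣ʳ (toℕ c) (divides (toℕ p) refl) ⟩
        toℕ c / q + toℕ p * q / q                  ≡⟨ cong₂ _+_ (m<n⇒m/n≡0 (toℕ<n c)) (m*n/n≡m (toℕ p) q) ⟩
        toℕ p                                      ∎))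

    residue-vertex : ∀ x → residue (vertex x) ≡ x
    residue-vertex x = begin
      (toℕ (part x) + toℕ (position x) * q) mod v
        ≡⟨ cong₂ (λ a b → (a + b * q) mod v) (toℕ-mod (toℕ x)) (toℕ-position x) ⟩
      (toℕ x % q + toℕ x / q * q) mod v            ≡⟨ cong (_mod v) (m≡m%n+[m/n]*n (toℕ x) q) ⟨
      toℕ x mod v                                  ≡⟨ mod-toℕ x ⟩
      x                                            ∎

  vertices : (Fin q × Fin t) ↔ Fin v
  vertices = mk↔ₛ′ residue vertex residue-vertex vertex-residue

  -- The kernel of the homomorphism `part`, a decidable description of the subgroup of multiples of
  -- q; two residues lie in the same part exactly when their difference is in it.
  Null : Fin v → Set
  Null x = part x ≡ 0 mod q

  open Group (cyclicGroup v) using (_\\_)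
  open GroupProperties (cyclicGroup v) using (\\-leftDividesˡ)
  open GroupProperties (cyclicGroup q) using (identityʳ-unique)
  open Group (cyclicGroup q) using (identityʳ)

  Null⇒part≡ : ∀ {x y} → Null (x \\ y) → part x ≡ part y
  Null⇒part≡ {x} {y} null = begin
    part x                       ≡⟨ identityʳ (part x) ⟨
    part x +ᵥ (0 mod q)          ≡⟨ cong (part x +ᵥ_) null ⟨
    part x +ᵥ part (x \\ y)      ≡⟨ part-+ x (x \\ y) ⟨
    part (x +ᵥ (x \\ y))         ≡⟨ cong part (\\-leftDividesˡ x y) ⟩
    part y                       ∎

  part≡⇒Null : ∀ {x y} → part x ≡ part y → Null (x \\ y)
  part≡⇒Null {x} {y} eq = identityʳ-unique (part x) (part (x \\ y)) (begin
    part x +ᵥ part (x \\ y)      ≡⟨ part-+ x (x \\ y) ⟨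
    part (x +ᵥ (x \\ y))         ≡⟨ cong part (\\-leftDividesˡ x y) ⟩
    part y                       ≡⟨ eq ⟨
    part x                       ∎)

  Null-neg : ∀ {x} → Null x → Null (-ᵥ x)
  Null-neg {x} null = identityʳ-unique (part x) (part (-ᵥ x)) (begin
    part x +ᵥ part (-ᵥ x)  ≡⟨ part-+ x (-ᵥ x) ⟨
    part (x +ᵥ -ᵥ x)       ≡⟨ cong part (Group.inverseʳ (cyclicGroup v) x) ⟩
    part (0 mod v)         ≡⟨ part-mod 0 ⟩
    0 mod q                ≡⟨ null ⟨
    part x                 ∎)

  multiples : List (Fin v)
  multiples = map (λ p → residue (0 mod q , p)) (allFin t)

  length-multiples : length multiples ≡ t
  length-multiples = trans (length-map (λ p → residue (0 mod q , p)) (allFin t)) (length-tabulate (λ p → p))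

  Null⇒∈multiples : ∀ {x} → Null x → x ∈ multiples
  Null⇒∈multiples {x} null = subst (_∈ multiples)
    (trans (cong (λ c → residue (c , proj₂ (vertex x))) (trans (sym null) (sym (part-vertex x)))) (residue-vertex x))
    (∈-map⁺ (λ p → residue (0 mod q , p)) (∈-allFin (proj₂ (vertex x))))

-- Quasi-Heffter arrays

module _ {v : ℕ} .{{_ : NonZero v}} where

  open GroupProperties (cyclicGroup v) using (⁻¹-involutive)

  length-± : (xs : List (Fin v)) → length (± xs) ≡ 2 * length xs
  length-± []       = refl
  length-± (x ∷ xs) = begin
    2 + length (± xs)   ≡⟨ cong (2 +_) (length-± xs) ⟩
    2 + 2 * length xs   ≡⟨ ℕ.*-suc 2 (length xs) ⟨
    2 * suc (length xs) ∎

  ∈-±ˡ : ∀ {x} {xs : List (Fin v)} → x ∈ xs → x ∈ ± xs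
  ∈-±ˡ (here refl) = here refl
  ∈-±ˡ (there x∈)  = there (there (∈-±ˡ x∈))

  ∈-±ʳ : ∀ {x} {xs : List (Fin v)} → -ᵥ x ∈ xs → x ∈ ± xs
  ∈-±ʳ {x} (here refl) = there (here (sym (⁻¹-involutive x)))
  ∈-±ʳ     (there x∈)  = there (there (∈-±ʳ x∈))

  ∈-±⁻ : ∀ {x} (xs : List (Fin v)) → x ∈ ± xs → x ∈ xs ⊎ -ᵥ x ∈ xs
  ∈-±⁻ (y ∷ xs) (here refl)         = inj₁ (here refl)
  ∈-±⁻ (y ∷ xs) (there (here refl)) = inj₂ (here (⁻¹-involutive y))
  ∈-±⁻ (y ∷ xs) (there (there x∈)) with ∈-±⁻ xs x∈
  ... | inj₁ x∈xs  = inj₁ (there x∈xs)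
  ... | inj₂ -x∈xs = inj₂ (there -x∈xs)

  unique-±⁻ : ∀ {xs : List (Fin v)} → Unique (± xs) →
              Unique xs × (∀ {x} → x ∈ xs → -ᵥ x ∉ xs)
  unique-±⁻ {[]} u = [] , λ ()
  unique-±⁻ {y ∷ xs} (y≢@(y≢-y ∷ y≢±xs) ∷ -y≢ ∷ u) with unique-±⁻ u
  ... | uxs , opposite =
    All.tabulate (λ z∈ → All.lookup y≢±xs (∈-±ˡ z∈)) ∷ uxs , λ
    { (here refl) (here -y≡y)   → y≢-y (sym -y≡y)
    ; (here refl) (there -y∈)   → All.lookup -y≢ (∈-±ˡ -y∈) refl
    ; (there x∈)  (here -x≡y)   → All.lookup -y≢ (∈-±ˡ x∈) (trans (cong -ᵥ_ (sym -x≡y)) (⁻¹-involutive _))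
    ; (there x∈)  (there -x∈)   → opposite x∈ -x∈ }

  multiplicity≡1⇒∈ : ∀ {x} (xs : List (Fin v)) → multiplicity x xs ≡ 1 → x ∈ xs
  multiplicity≡1⇒∈ {x} xs eq with filter (_≟ x) xs in filtered
  ... | y ∷ _ with ∈-filter⁻ (_≟ x) {xs = xs} (subst (y ∈_) (sym filtered) (here refl))
  ...   | y∈xs , refl = y∈xs

module QuasiHeffter {m n v t h k : ℕ} .{{_ : NonZero t}} .{{_ : NonZero v}} .{{_ : NonZero (v / t)}}
                    {A : PFArray (Fin v) m n} (quasiHeffter : IsQuasiHeffter t h k A) where

  open IsQuasiHeffter quasiHeffter

  v/t*t≡v : v / t * t ≡ v
  v/t*t≡v = m/n*n≡m (subst (t ∣_) (sym order) (∣m∣n⇒∣m+n t-divides ∣-refl))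

  open Residues (v / t) t v v/t*t≡v public

  J⇒Null : ∀ {x} → J v t x → Null x
  J⇒Null (y , refl) = trans (part-mod (v / t * toℕ y)) (mod-cong (begin
    v / t * toℕ y % (v / t)       ≡⟨ cong (_% (v / t)) (ℕ.*-comm (v / t) (toℕ y)) ⟩
    toℕ y * (v / t) % (v / t)     ≡⟨ m*n%n≡0 (toℕ y) (v / t) ⟩
    0                             ≡⟨ m*n%n≡0 0 (v / t) ⟨
    0 % (v / t)                   ∎))

  Null? : Decidable Null
  Null? x = part x ≟ 0 mod (v / t)

  ¬Null⇒∈± : ∀ {x} → ¬ Null x → x ∈ ± (entries A)
  ¬Null⇒∈± {x} ¬null = multiplicity≡1⇒∈ (± (entries A)) (exactly-once x (¬null ∘ J⇒Null))

  -- Counted by columns, since `order` expresses v through n and k.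
  length-entries : length (entries A) ≡ n * k
  length-entries = trans (↭-length (entries-transpose A)) (length-union (column A) column-filled)

  covering : List (Fin v)
  covering = ± (entries A) ++ multiples

  length-covering : length covering ≡ v
  length-covering = begin
    length covering                         ≡⟨ length-++ (± (entries A)) ⟩
    length (± (entries A)) + length multiples ≡⟨ cong₂ _+_ (length-± (entries A)) length-multiples ⟩
    2 * length (entries A) + t              ≡⟨ cong (λ l → 2 * l + t) length-entries ⟩
    2 * (n * k) + t                         ≡⟨ cong (_+ t) (ℕ.*-assoc 2 n k) ⟨
    2 * n * k + t                           ≡⟨ order ⟨
    v                                       ∎

  covers : ∀ x → x ∈ covering
  covers x with Null? x
  ... | yes null = ∈-++⁺ʳ (± (entries A)) (Null⇒∈multiples null)
  ... | no ¬null = ∈-++⁺ˡ (¬Null⇒∈± ¬null)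

  -- Having exactly as many terms as there are residues, the covering list
  -- repeats none: this gives at once that entries are distinct, are never
  -- opposite to each other and avoid J.
  unique-covering : Unique (± (entries A)) × Unique multiples × Disjoint (± (entries A)) multiples
  unique-covering = unique-++⁻ (± (entries A)) (covering⇒unique covering length-covering covers)

  unique-entries : Unique (entries A)
  unique-entries = proj₁ (unique-±⁻ (proj₁ unique-covering))

  opposite-∉ : ∀ {x} → x ∈ entries A → -ᵥ x ∉ entries A
  opposite-∉ = proj₂ (unique-±⁻ (proj₁ unique-covering))

  ∈⇒¬Null : ∀ {x} → x ∈ entries A → ¬ Null x
  ∈⇒¬Null x∈ null = proj₂ (proj₂ unique-covering) (∈-±ˡ x∈ , Null⇒∈multiples null)

  ¬Null⇒∈ : ∀ {x} → ¬ Null x → x ∈ entries A ⊎ -ᵥ x ∈ entries A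
  ¬Null⇒∈ ¬null = ∈-±⁻ (entries A) (¬Null⇒∈± ¬null)

  unique-columns : Unique (concat (tabulate (column A)))
  unique-columns = SetoidPermutation.Unique-resp-↭ (setoid (Fin v)) (↭⇒↭ₛ (entries-transpose A)) unique-entries

-- The embedding

module ArchdeaconEmbedding
  {m n v t h k : ℕ} .{{_ : NonZero t}} .{{_ : NonZero v}} .{{_ : NonZero (v / t)}}
  {A : PFArray (Fin v) m n} (quasiHeffter : IsQuasiHeffter t h k A) (orderings : CompatibleOrderings A)
  {entry : Fin v} (entry∈ : entry ∈ entries A) where

  open QuasiHeffter quasiHeffter
  open IsQuasiHeffter quasiHeffter
  open CompatibleOrderings orderings
  open Group (cyclicGroup v) using (_\\_; identityˡ; assoc)
  open GroupProperties (cyclicGroup v)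
  open DecMembership (_≟_ {v}) using (_∈?_)

  module Rows    = CyclesOnUnion (row A) ωR ωR-cyclic unique-entries row-filled
  module Columns = CyclesOnUnion (column A) ωC ωC-cyclic unique-columns column-filled

  -- The permutation r and its single cycle off J

  E : Fin v → Set
  E = _∈ entries A

  R C : Perm (Fin v)
  R = compose ωR
  C = compose ωC

  columns⇒E : ∀ {x} → x ∈ concat (tabulate (column A)) → E x
  columns⇒E = ∈-resp-↭ (↭-sym (entries-transpose A))

  C-fixes : ∀ {x} → ¬ E x → to C x ≡ x
  C-fixes ¬Ex = Columns.Ω-fixes (¬Ex ∘ columns⇒E)

  R-preserves : ∀ {x} → E x → E (to R x)
  R-preserves = preserves (_∈? entries A) R Rows.Ω-fixes

  C-preserves : ∀ {x} → E x → E (to C x)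
  C-preserves = preserves (_∈? entries A) C C-fixes

  -- The reversal of differences off J; on J it is the identity, because a
  -- rotation fixes the non-neighbours.
  reverse : Fin v → Fin v
  reverse x with Null? x
  ... | yes _ = x
  ... | no  _ = -ᵥ x

  reverse-Null : ∀ {x} → Null x → reverse x ≡ x
  reverse-Null {x} null with Null? x
  ... | yes _    = refl
  ... | no ¬null = contradiction null ¬null

  reverse-¬Null : ∀ {x} → ¬ Null x → reverse x ≡ -ᵥ x
  reverse-¬Null {x} ¬null with Null? x
  ... | yes null = contradiction null ¬null
  ... | no _     = refl

  reverse-involutive : ∀ x → reverse (reverse x) ≡ x
  reverse-involutive x with Null? x
  ... | yes null = reverse-Null null
  ... | no ¬null = trans (reverse-¬Null (¬null ∘ subst Null (⁻¹-involutive x) ∘ Null-neg)) (⁻¹-involutive x)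

  -- One composite covers every case, and is bijective by construction: `R` and `C` are the identity
  -- off E, while `reverse` exchanges E and -E. On E only `R` and the reversal have an effect, on -E
  -- only the reversal and `C`, on J nothing.
  r : Perm (Fin v)
  r = C ↔-∘ (mk↔ₛ′ reverse reverse reverse-involutive reverse-involutive ↔-∘ R)

  r-E : ∀ {x} → E x → to r x ≡ -ᵥ to R x
  r-E Ex = trans (cong (to C) (reverse-¬Null (∈⇒¬Null (R-preserves Ex))))
                 (C-fixes (opposite-∉ (R-preserves Ex)))

  r-neg : ∀ {x} → E x → to r (-ᵥ x) ≡ to C x
  r-neg {x} Ex = cong (to C) (begin
    reverse (to R (-ᵥ x))  ≡⟨ cong reverse (Rows.Ω-fixes (opposite-∉ Ex)) ⟩
    reverse (-ᵥ x)         ≡⟨ cong reverse (reverse-¬Null (∈⇒¬Null Ex)) ⟨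
    reverse (reverse x)    ≡⟨ reverse-involutive x ⟩
    x                      ∎)

  r-fixes : ∀ {x} → Null x → to r x ≡ x
  r-fixes {x} null = begin
    to C (reverse (to R x))  ≡⟨ cong (to C ∘ reverse) (Rows.Ω-fixes ¬Ex) ⟩
    to C (reverse x)         ≡⟨ cong (to C) (reverse-Null null) ⟩
    to C x                   ≡⟨ C-fixes ¬Ex ⟩
    x                        ∎
    where
    ¬Ex : ¬ E x
    ¬Ex Ex = ∈⇒¬Null Ex null

  -- Two steps lead from E through -E back to E. With the exponent written `i * 2`, a successor
  -- unfolds to exactly two more steps.
  iterate-r² : ∀ {x} → E x → ∀ i → iterate (to r) x (i * 2) ≡ iterate (to (C ↔-∘ R)) x i
  iterate-r² Ex zero = refl
  iterate-r² {x} Ex (suc i) = begin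
    iterate (to r) (to r (to r x)) (i * 2)       ≡⟨ cong (λ y → iterate (to r) y (i * 2)) r² ⟩
    iterate (to r) (to C (to R x)) (i * 2)       ≡⟨ iterate-r² (C-preserves (R-preserves Ex)) i ⟩
    iterate (to (C ↔-∘ R)) (to C (to R x)) i     ∎
    where
    r² : to r (to r x) ≡ to C (to R x)
    r² = trans (cong (to r) (r-E Ex)) (r-neg (R-preserves Ex))

  Reaches : Fin v → Fin v → Set
  Reaches x y = ∃ λ i → iterate (to r) x i ≡ y

  reaches-E : ∀ {x y} → E x → E y → Reaches x y
  reaches-E Ex Ey with i , eq ← CyclicOn.transitive compatible Ex Ey = i * 2 , trans (iterate-r² Ex i) eq

  reaches-from-E : ∀ {x y} → E x → ¬ Null y → Reaches x y
  reaches-from-E {x} {y} Ex ¬null with ¬Null⇒∈ ¬null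
  ... | inj₁ Ey  = reaches-E Ex Ey
  -- Here y is in -E. Since r(z) = -R(z) on E, its predecessor under r is z = R⁻¹(-y), an entry that
  -- can be reached.
  ... | inj₂ E-y with Ez ← preserves⁻¹ (_∈? entries A) R Rows.Ω-fixes E-y
                 with i , eq ← reaches-E Ex Ez = i + 1 , (begin
    iterate (to r) x (i + 1)              ≡⟨ iterate-+ (to r) x i ⟩
    to r (iterate (to r) x i)             ≡⟨ cong (to r) eq ⟩
    to r (from R (-ᵥ y))                  ≡⟨ r-E Ez ⟩
    -ᵥ to R (from R (-ᵥ y))               ≡⟨ cong -ᵥ_ (Inverse.strictlyInverseˡ R (-ᵥ y)) ⟩
    -ᵥ -ᵥ y                               ≡⟨ ⁻¹-involutive y ⟩
    y                                     ∎)

  reaches : ∀ {x y} → ¬ Null x → ¬ Null y → Reaches x y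
  reaches {x} ¬null-x ¬null-y with ¬Null⇒∈ ¬null-x
  ... | inj₁ Ex  = reaches-from-E Ex ¬null-y
  -- From -E a single step of r lands on the entry C(-x).
  ... | inj₂ E-x with i , eq ← reaches-from-E
                   (subst E (sym (trans (cong (to r) (sym (⁻¹-involutive x))) (r-neg E-x))) (C-preserves E-x)) ¬null-y
                 = suc i , eq

  -- The rotation system

  open Graph (K (v / t) t)

  translation : Fin v → Perm (Fin v)
  translation a = mk↔ₛ′ (a +ᵥ_) (a \\_) (\\-leftDividesˡ a) (\\-leftDividesʳ a)

  \\-translation : ∀ a x y → (a +ᵥ x) \\ (a +ᵥ y) ≡ x \\ y
  \\-translation a x y = begin
    -ᵥ (a +ᵥ x) +ᵥ (a +ᵥ y)          ≡⟨ cong (_+ᵥ (a +ᵥ y)) (⁻¹-anti-homo-∙ a x) ⟩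
    (-ᵥ x +ᵥ -ᵥ a) +ᵥ (a +ᵥ y)       ≡⟨ assoc (-ᵥ x) (-ᵥ a) (a +ᵥ y) ⟩
    -ᵥ x +ᵥ (a \\ (a +ᵥ y))          ≡⟨ cong (-ᵥ x +ᵥ_) (\\-leftDividesʳ a y) ⟩
    x \\ y                           ∎

  residue-injective : ∀ {x y} → residue x ≡ residue y → x ≡ y
  residue-injective = to-injective vertices

  rotationAt : V → Perm V
  rotationAt x = ↔-sym vertices ↔-∘
    ((translation (residue x) ↔-∘ (r ↔-∘ ↔-sym (translation (residue x)))) ↔-∘ vertices)

  δ : V × V → Fin v
  δ (x , y) = residue x \\ residue y

  δ-swap : ∀ d → δ (swap d) ≡ -ᵥ δ d
  δ-swap (x , y) = sym (⁻¹-anti-homo-\\ (residue x) (residue y))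

  E-swap : ∀ {d} → E (δ d) → E (-ᵥ δ (swap d))
  E-swap {d} = subst E (sym (trans (cong -ᵥ_ (δ-swap d)) (⁻¹-involutive (δ d))))

  E-swap⁻ : ∀ {d} → E (-ᵥ δ d) → E (δ (swap d))
  E-swap⁻ {d} = subst E (sym (δ-swap d))

  residue-rotationAt : ∀ x y → residue (to (rotationAt x) y) ≡ residue x +ᵥ to r (δ (x , y))
  residue-rotationAt x y = residue-vertex (residue x +ᵥ to r (δ (x , y)))

  δ-rotationAt : ∀ x y → δ (x , to (rotationAt x) y) ≡ to r (δ (x , y))
  δ-rotationAt x y =
    trans (cong (residue x \\_) (residue-rotationAt x y)) (\\-leftDividesʳ (residue x) (to r (δ (x , y))))

  part-residue : ∀ (x : V) → part (residue x) ≡ proj₁ x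
  part-residue x = trans (sym (part-vertex (residue x))) (cong proj₁ (vertex-residue x))

  Adj⇒¬Null : ∀ x y → Adj x y → ¬ Null (δ (x , y))
  Adj⇒¬Null x y adj null =
    adj (trans (sym (part-residue x)) (trans (Null⇒part≡ null) (part-residue y)))

  ¬Null⇒Adj : ∀ x y → ¬ Null (δ (x , y)) → Adj x y
  ¬Null⇒Adj x y ¬null eq =
    ¬null (part≡⇒Null (trans (part-residue x) (trans eq (sym (part-residue y)))))

  rotationAt-cyclic : ∀ x → CyclicOn (Adj x) (rotationAt x)
  rotationAt-cyclic x = record { fixes = fixes ; transitive = transitive }
    where
    fixes : ∀ {y} → ¬ Adj x y → to (rotationAt x) y ≡ y
    fixes {y} ¬adj = residue-injective (begin
      residue (to (rotationAt x) y)       ≡⟨ residue-rotationAt x y ⟩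
      residue x +ᵥ to r (δ (x , y))       ≡⟨ cong (residue x +ᵥ_) (r-fixes null) ⟩
      residue x +ᵥ δ (x , y)              ≡⟨ \\-leftDividesˡ (residue x) (residue y) ⟩
      residue y                           ∎)
      where
      null : Null (δ (x , y))
      null = decidable-stable (Null? (δ (x , y))) (¬adj ∘ ¬Null⇒Adj x y)
    transitive : ∀ {y z} → Adj x y → Adj x z → ∃ λ i → iterate (to (rotationAt x)) y i ≡ z
    -- For fixed x, `δ (x , w)` is injective in w and turns the rotation at x into r, so an exponent
    -- found for r serves here too.
    transitive {y} {z} xy xz with i , eq ← reaches (Adj⇒¬Null x y xy) (Adj⇒¬Null x z xz) =
      i , residue-injective (to-injective (↔-sym (translation (residue x)))
            (trans (iterate-map {Q = λ _ → ⊤} (λ w → δ (x , w)) (λ {w} _ → δ-rotationAt x w) (λ _ → tt) tt i) eq))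

  -- The fixed entry is a difference outside J, so adding it leaves the part.
  Adj-translate : ∀ x → Adj x (vertex (residue x +ᵥ entry))
  Adj-translate x = ¬Null⇒Adj x (vertex (residue x +ᵥ entry)) (subst (¬_ ∘ Null) (sym (begin
    residue x \\ residue (vertex (residue x +ᵥ entry))  ≡⟨ cong (residue x \\_) (residue-vertex (residue x +ᵥ entry)) ⟩
    residue x \\ (residue x +ᵥ entry)                   ≡⟨ \\-leftDividesʳ (residue x) entry ⟩
    entry                                               ∎)) (∈⇒¬Null entry∈))

  connected : ∀ x y → Star Adj x y
  connected x y with proj₁ x ≟ proj₁ y
  ... | no  xy = _◅_ {j = y} xy ε
  -- As x and y share a part, the neighbour z of x is a neighbour of y as well.
  ... | yes eq = _◅_ {j = z} (Adj-translate x) (_◅_ {j = y} (λ zy → Adj-translate x (trans eq (sym zy))) ε)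
    where
    z : V
    z = vertex (residue x +ᵥ entry)

  embedding : Embedding (K (v / t) t)
  embedding = record { connected = connected ; ρ = rotationAt ; rotation = rotationAt-cyclic }

  -- Differences along faces, and face lengths

  open Embedding embedding hiding (connected; ρ; rotation)

  δ-next : ∀ d → δ (next d) ≡ to r (-ᵥ δ d)
  δ-next d@(x , y) = trans (δ-rotationAt y x) (cong (to r) (δ-swap d))

  δ-next-E : ∀ {d} → E (δ d) → δ (next d) ≡ to C (δ d)
  δ-next-E {d} Eδ = trans (δ-next d) (r-neg Eδ)

  -δ-next-E : ∀ {d} → E (-ᵥ δ d) → -ᵥ δ (next d) ≡ to R (-ᵥ δ d)
  -δ-next-E {d} E-δ = begin
    -ᵥ δ (next d)           ≡⟨ cong -ᵥ_ (δ-next d) ⟩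
    -ᵥ to r (-ᵥ δ d)        ≡⟨ cong -ᵥ_ (r-E E-δ) ⟩
    -ᵥ -ᵥ to R (-ᵥ δ d)     ≡⟨ ⁻¹-involutive (to R (-ᵥ δ d)) ⟩
    to R (-ᵥ δ d)           ∎

  next-injective : Injective _≡_ _≡_ next
  next-injective {x , y} {x′ , y′} eq with refl ← cong proj₁ eq =
    cong (_, y) (to-injective (rotationAt y) (cong proj₂ eq))

  dart-code : Dart → Fin (v * v)
  dart-code (x , y) = combine (residue x) (residue y)

  dart-code-injective : Injective _≡_ _≡_ dart-code
  dart-code-injective {x , y} {x′ , y′} eq
    with combine-injective (residue x) (residue y) (residue x′) (residue y′) eq
  ... | eqˣ , eqʸ = cong₂ _,_ (residue-injective eqˣ) (residue-injective eqʸ)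

  -- `next` is injective on all of V × V, which `dart-code` embeds in a finite set, so a least
  -- return time exists; a divisor of all return times divides it.
  faceLengthMultipleOf : ∀ {s} d → (∀ {ℓ} → walk d ℓ ≡ d → s ∣ ℓ) → FaceLengthMultipleOf s d
  faceLengthMultipleOf d closed⇒∣
    with ℓ , period ← period-exists {N = v * v} {next} {dart-code} dart-code-injective next-injective d =
    ℓ , record { IsPeriod period } , closed⇒∣ (IsPeriod.closes period)

  faces-E : ∀ {d} → E (δ d) → FaceLengthMultipleOf k d
  faces-E {d} Eδ = faceLengthMultipleOf d λ {ℓ} closed →
    Columns.Ω-period (∈-resp-↭ (entries-transpose A) Eδ) {ℓ}
      (trans (sym (iterate-map {Q = E} δ (λ {d} → δ-next-E {d}) (λ {y} → C-preserves {y}) {d} Eδ ℓ)) (cong δ closed))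

  faces-opposite : ∀ {d} → E (-ᵥ δ d) → FaceLengthMultipleOf h d
  faces-opposite {d} E-δ = faceLengthMultipleOf d λ {ℓ} closed →
    Rows.Ω-period E-δ {ℓ}
      (trans (sym (iterate-map {Q = E} (-ᵥ_ ∘ δ) (λ {d} → -δ-next-E {d}) (λ {y} → R-preserves {y}) {d} E-δ ℓ))
             (cong (-ᵥ_ ∘ δ) closed))

  hasFaces : ∀ d → IsDart d → HasFacesOfLengths h k d
  hasFaces d@(x , y) dart with ¬Null⇒∈ (Adj⇒¬Null x y dart)
  ... | inj₁ Eδ  = inj₂ (faces-E {d} Eδ , faces-opposite {swap d} (E-swap {d} Eδ))
  ... | inj₂ E-δ = inj₁ (faces-opposite {d} E-δ , faces-E {swap d} (E-swap⁻ {d} E-δ))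

  -- The two colours of the faces

  colour : Dart → Bool
  colour d = does (δ d ∈? entries A)

  colour-E : ∀ {d} → E (δ d) → colour d ≡ true
  colour-E {d} = dec-true (δ d ∈? entries A)

  colour-opposite : ∀ {d} → E (-ᵥ δ d) → colour d ≡ false
  colour-opposite {d} E-δ = dec-false (δ d ∈? entries A) λ Eδ → opposite-∉ Eδ E-δ

  -- Along a face the difference stays in E or stays in -E, as `C` and `R` preserve E; passing to
  -- the other side of an edge negates it, and E and -E are disjoint.
  biembedding : IsBiembedding
  biembedding = record { colour = colour ; well-defined = well-defined ; both-colours = both-colours }
    where
    well-defined : ∀ {d} → IsDart d → ∀ i → colour (walk d i) ≡ colour d
    well-defined {d@(x , y)} dart i with ¬Null⇒∈ (Adj⇒¬Null x y dart)
    ... | inj₁ Eδ  = trans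
      (colour-E {walk d i} (iterate-preserves (E ∘ δ)
        (λ {e} Eδ → subst E (sym (δ-next-E {e} Eδ)) (C-preserves Eδ)) Eδ i))
      (sym (colour-E {d} Eδ))
    ... | inj₂ E-δ = trans
      (colour-opposite {walk d i} (iterate-preserves (E ∘ -ᵥ_ ∘ δ)
        (λ {e} E-δ → subst E (sym (-δ-next-E {e} E-δ)) (R-preserves E-δ)) E-δ i))
      (sym (colour-opposite {d} E-δ))
    both-colours : ∀ {d} → IsDart d → colour d ≢ colour (swap d)
    both-colours {d@(x , y)} dart eq with ¬Null⇒∈ (Adj⇒¬Null x y dart)
    ... | inj₁ Eδ  = contradiction (trans (sym (colour-E {d} Eδ)) (trans eq (colour-opposite {swap d}
                       (E-swap {d} Eδ)))) λ ()
    ... | inj₂ E-δ = contradiction (trans (sym (colour-opposite {d} E-δ)) (trans eq (colour-E {swap d}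
                       (E-swap⁻ {d} E-δ)))) λ ()

  -- The action of ℤ_v by translations

  φ : Fin v → Perm V
  φ a = ↔-sym vertices ↔-∘ (translation a ↔-∘ vertices)

  residue-φ : ∀ a x → residue (to (φ a) x) ≡ a +ᵥ residue x
  residue-φ a x = residue-vertex (a +ᵥ residue x)

  φ-homo : ∀ a b x → to (φ (a +ᵥ b)) x ≡ to (φ a) (to (φ b) x)
  φ-homo a b x = cong vertex (trans (assoc a b (residue x)) (cong (a +ᵥ_) (sym (residue-φ b x))))

  φ-injective : ∀ {a b} x → to (φ a) x ≡ to (φ b) x → a ≡ b
  φ-injective {a} {b} x eq = ∙-cancelʳ (residue x) a b
    (trans (sym (residue-φ a x)) (trans (cong residue eq) (residue-φ b x)))

  δ-φ : ∀ a x y → δ (to (φ a) x , to (φ a) y) ≡ δ (x , y)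
  δ-φ a x y = trans (cong₂ _\\_ (residue-φ a x) (residue-φ a y)) (\\-translation a (residue x) (residue y))

  -- The rotation at x adds to x a function of the difference alone, and translations preserve
  -- differences.
  φ-rotationAt : ∀ a x y → to (φ a) (to (rotationAt x) y) ≡ to (rotationAt (to (φ a) x)) (to (φ a) y)
  φ-rotationAt a x y = cong vertex (begin
    a +ᵥ residue (to (rotationAt x) y)           ≡⟨ cong (a +ᵥ_) (residue-rotationAt x y) ⟩
    a +ᵥ (residue x +ᵥ to r (δ (x , y)))         ≡⟨ assoc a (residue x) (to r (δ (x , y))) ⟨
    (a +ᵥ residue x) +ᵥ to r (δ (x , y))         ≡⟨ cong₂ (λ z d → z +ᵥ to r d) (residue-φ a x) (δ-φ a x y) ⟨
    residue (to (φ a) x) +ᵥ to r (δ (to (φ a) x , to (φ a) y))  ∎)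

  φ-automorphism : ∀ a → IsAutomorphism (φ a)
  φ-automorphism a = record
    { adjacency = λ {x} {y} → mk⇔ (φ-Adj x y) (φ-Adj⁻ x y)
    -- Translations commute with `next`, hence keep the orientation, and the image face starts at
    -- the translated dart.
    ; faces     = λ {d} dart → φ₂ d , φ-Adj (proj₁ d) (proj₂ d) dart , inj₁ (φ-walk d)
    }
    where
    φ₂ : Dart → Dart
    φ₂ = Product.map (to (φ a)) (to (φ a))
    φ-Adj : ∀ x y → Adj x y → Adj (to (φ a) x) (to (φ a) y)
    φ-Adj x y adj = ¬Null⇒Adj (to (φ a) x) (to (φ a) y) (subst (¬_ ∘ Null) (sym (δ-φ a x y)) (Adj⇒¬Null x y adj))
    φ-Adj⁻ : ∀ x y → Adj (to (φ a) x) (to (φ a) y) → Adj x y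
    φ-Adj⁻ x y adj = ¬Null⇒Adj x y (subst (¬_ ∘ Null) (δ-φ a x y) (Adj⇒¬Null (to (φ a) x) (to (φ a) y) adj))
    φ-next : ∀ d → φ₂ (next d) ≡ next (φ₂ d)
    φ-next (x , y) = cong (to (φ a) y ,_) (φ-rotationAt a y x)
    φ-walk : ∀ d i → φ₂ (walk d i) ≡ walk (φ₂ d) i
    φ-walk d = iterate-map {Q = λ _ → ⊤} {f = next} {f′ = next} φ₂ (λ {e} _ → φ-next e) (λ _ → tt) {d} tt

  regular : IsRegular v
  regular = record
    { φ                  = φ
    ; monomorphism       = record
      { isGroupHomomorphism = record
        { isMonoidHomomorphism = record
          { isMagmaHomomorphism = record
            { isRelHomomorphism = record { cong = λ { refl x → refl } }
            ; homo              = φ-homo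
            }
          ; ε-homo = φ-ε
          }
        -- Holds by computation: the inverse of `translation a` is left division by a, which unfolds
        -- to adding `-ᵥ a`.
        ; ⁻¹-homo = λ a x → refl
        }
      -- Translations agreeing at one vertex are equal; the vertex of the fixed entry serves as base
      -- point.
      ; injective = λ eq → φ-injective (vertex entry) (eq (vertex entry))
      }
    ; automorphism       = φ-automorphism
    ; sharply-transitive = λ x y → residue y // residue x ,
        φ-// x y ,
        λ {a} eq → φ-injective x (trans (φ-// x y) (sym eq))
    }
    where
    open Group (cyclicGroup v) using (_//_)
    φ-// : ∀ x y → to (φ (residue y // residue x)) x ≡ y
    φ-// x y = residue-injective (trans (residue-φ (residue y // residue x) x)
                                        (//-rightDividesˡ (residue x) (residue y)))
    φ-ε : ∀ x → to (φ (0 mod v)) x ≡ x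
    φ-ε x = trans (cong vertex (identityˡ (residue x))) (vertex-residue x)

nonempty : ∀ (xs : List X) {l} → length xs ≡ suc l → ∃ λ x → x ∈ xs
nonempty (x ∷ xs) _ = x , here refl

theorem2p8 : (m n h k t v : ℕ) .{{_ : NonZero m}} .{{_ : NonZero n}} .{{_ : NonZero h}} .{{_ : NonZero k}} .{{_ : NonZero t}} .{{_ : NonZero v}} →
    (A : PFArray (Fin v) m n) → IsQuasiHeffter t h k A → CompatibleOrderings A →
    Σ (Embedding (K (v / t) t)) λ ψ →
    Embedding.IsBiembedding ψ
    × (∀ d → Embedding.IsDart ψ d → Embedding.HasFacesOfLengths ψ h k d)
    × Embedding.IsRegular ψ v
-- With m and h successors there is a first row and it has a filled cell, which supplies the entry
-- fixed throughout the construction.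
theorem2p8 (suc m) n (suc h) k t v A quasiHeffter orderings =
  embedding , biembedding , hasFaces , regular
  where
  open IsQuasiHeffter quasiHeffter
  -- Makes the number v / t of parts positive, so that reduction modulo v / t is available.
  t≤v : t ≤ v
  t≤v = subst (t ≤_) (sym order) (ℕ.m≤n+m t (2 * n * k))
  instance
    v/t≢0 : NonZero (v / t)
    v/t≢0 = >-nonZero (m≥n⇒m/n>0 t≤v)
  entry : ∃ λ x → x ∈ row A zero
  entry = nonempty (row A zero) (row-filled zero)
  open ArchdeaconEmbedding quasiHeffter orderings (∈-union (row A) zero (proj₂ entry))
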